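{- Let $G$ be a finite simple graph on $n$ vertices with $\alpha(G)\le 2$ that contains no induced subgraph isomorphic to the one-wall-house graph. Then $G$ contains $K_{\lceil n/2\rceil}$ as an immersion.
   Context: $\alpha(G)$ is the independence number. The one-wall-house graph is the 5-vertex graph with vertices $a,b,c,d,e$ and edges $ab, be, ea, ad, dc$ (a triangle $a,b,e$ with a path $a,d,c$ of length two attached at $a$; i.e. the house graph with one wall edge removed). A graph $G$ contains a graph $K$ as an immersion if there is an injective map $\phi\colon V(K)\to V(G)$ such that for every edge $uv\in E(K)$ there is a path $P_{uv}$ in $G$ with endpoints $\phi(u),\phi(v)$, the paths $P_{uv}$ are pairwise edge-disjoint, and no vertex of $\phi(V(K))$ is an interior vertex of any path $P_{uv}$. -}

module Defs where

open import Data.Nat using (ℕ; _≤_; ⌈_/2⌉)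
open import Data.Fin using (Fin; zero; suc; _<_)
open import Data.Bool using (Bool; true; false)
open import Data.List using (List; []; _∷_; _++_; length; zip)
open import Data.List.Membership.Propositional using (_∈_)
open import Data.List.Relation.Unary.All using (All)
open import Data.List.Relation.Unary.AllPairs using (AllPairs)
open import Data.List.Relation.Unary.Unique.Propositional using (Unique)
open import Data.List.Relation.Unary.Linked using (Linked)
open import Data.Product using (Σ; _×_; _,_)
open import Data.Sum using (_⊎_)
open import Data.Empty using (⊥)
open import Relation.Nullary using (¬_)
open import Relation.Binary.PropositionalEquality using (_≡_; _≢_)
open import Function.Definitions using (Injective)

record Graph (n : ℕ) : Set where
  field
    adj   : Fin n → Fin n → Bool
    sym   : ∀ x y → adj x y ≡ adj y x
    irrefl : ∀ x → adj x x ≡ false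

open Graph public

module _ {n : ℕ} (G : Graph n) where

  Adj : Fin n → Fin n → Set
  Adj x y = adj G x y ≡ true

  IsIndependent : List (Fin n) → Set
  IsIndependent S = Unique S × AllPairs (λ x y → ¬ Adj x y) S

  IndepNumberAtMost : ℕ → Set
  IndepNumberAtMost k = ∀ S → IsIndependent S → length S ≤ k

  HasInducedCopy : {m : ℕ} → Graph m → Set
  HasInducedCopy {m} H =
    Σ (Fin m → Fin n) λ f → Injective _≡_ _≡_ f × (∀ i j → adj G (f i) (f j) ≡ adj H i j)

  consecutive : List (Fin n) → List (Fin n × Fin n)
  consecutive []       = []
  consecutive (x ∷ xs) = zip (x ∷ xs) xs

  UsesEdge : List (Fin n) → Fin n → Fin n → Set
  UsesEdge ws x y = ((x , y) ∈ consecutive ws) ⊎ ((y , x) ∈ consecutive ws)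

  IsPath : List (Fin n) → Set
  IsPath ws = Unique ws × Linked Adj ws

  -- G contains the complete graph K_m as an immersion.
  -- For each pair u < v, P u v is the list of interior vertices of the path
  -- from φ u to φ v; the full path is φ u ∷ P u v ++ φ v ∷ [].
  ContainsKImmersion : ℕ → Set
  ContainsKImmersion m =
    Σ (Fin m → Fin n) λ φ →
    Σ (Fin m → Fin m → List (Fin n)) λ P →
      Injective _≡_ _≡_ φ
    × (∀ u v → u < v → IsPath (φ u ∷ P u v ++ φ v ∷ []))
    × (∀ u v → u < v → All (λ w → ∀ t → w ≢ φ t) (P u v))
    × (∀ u v u' v' → u < v → u' < v' → ¬ (u ≡ u' × v ≡ v') → ∀ x y →
         UsesEdge (φ u ∷ P u v ++ φ v ∷ []) x y →
         UsesEdge (φ u' ∷ P u' v' ++ φ v' ∷ []) x y → ⊥)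

-- The one-wall-house graph on a=0, b=1, c=2, d=3, e=4
-- with edges ab, be, ea, ad, dc.
houseAdj : Fin 5 → Fin 5 → Bool
houseAdj zero (suc zero) = true
houseAdj (suc zero) zero = true
houseAdj (suc zero) (suc (suc (suc (suc zero)))) = true
houseAdj (suc (suc (suc (suc zero)))) (suc zero) = true
houseAdj (suc (suc (suc (suc zero)))) zero = true
houseAdj zero (suc (suc (suc (suc zero)))) = true
houseAdj zero (suc (suc (suc zero))) = true
houseAdj (suc (suc (suc zero))) zero = true
houseAdj (suc (suc (suc zero))) (suc (suc zero)) = true
houseAdj (suc (suc zero)) (suc (suc (suc zero))) = true
houseAdj _ _ = false

oneWallHouse : Graph 5
oneWallHouse = record
  { adj = houseAdj
  ; sym = λ { zero zero → _≡_.refl ; zero (suc zero) → _≡_.refl ; zero (suc (suc zero)) → _≡_.refl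
            ; zero (suc (suc (suc zero))) → _≡_.refl ; zero (suc (suc (suc (suc zero)))) → _≡_.refl
            ; (suc zero) zero → _≡_.refl ; (suc zero) (suc zero) → _≡_.refl ; (suc zero) (suc (suc zero)) → _≡_.refl
            ; (suc zero) (suc (suc (suc zero))) → _≡_.refl ; (suc zero) (suc (suc (suc (suc zero)))) → _≡_.refl
            ; (suc (suc zero)) zero → _≡_.refl ; (suc (suc zero)) (suc zero) → _≡_.refl ; (suc (suc zero)) (suc (suc zero)) → _≡_.refl
            ; (suc (suc zero)) (suc (suc (suc zero))) → _≡_.refl ; (suc (suc zero)) (suc (suc (suc (suc zero)))) → _≡_.refl
            ; (suc (suc (suc zero))) zero → _≡_.refl ; (suc (suc (suc zero))) (suc zero) → _≡_.refl ; (suc (suc (suc zero))) (suc (suc zero)) → _≡_.refl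
            ; (suc (suc (suc zero))) (suc (suc (suc zero))) → _≡_.refl ; (suc (suc (suc zero))) (suc (suc (suc (suc zero)))) → _≡_.refl
            ; (suc (suc (suc (suc zero)))) zero → _≡_.refl ; (suc (suc (suc (suc zero)))) (suc zero) → _≡_.refl ; (suc (suc (suc (suc zero)))) (suc (suc zero)) → _≡_.refl
            ; (suc (suc (suc (suc zero)))) (suc (suc (suc zero))) → _≡_.refl ; (suc (suc (suc (suc zero)))) (suc (suc (suc (suc zero)))) → _≡_.refl }
  ; irrefl = λ { zero → _≡_.refl ; (suc zero) → _≡_.refl ; (suc (suc zero)) → _≡_.refl
               ; (suc (suc (suc zero))) → _≡_.refl ; (suc (suc (suc (suc zero)))) → _≡_.refl }
  }

-- Work in the complement H, which is triangle-free and in which a vertex adjacent to one vertex of a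
-- 4-cycle is adjacent to the opposite one. The branch vertices S and the remaining vertices T halve V;
-- an H-edge uv inside S is replaced by a path u – t – v with t ∈ T. These paths are edge-disjoint
-- if the vertices t form a proper edge colouring of H[S], the colour of uv being H-adjacent to neither end.
-- Such a colouring is built by induction on V. A 4-cycle of H lies in a complete bipartite component,
-- whose larger side goes to S. Otherwise let x have minimum degree δ. If 2(δ + deg z) ≤ |V| + 2 for every
-- neighbour z of x, delete x and any y, put x into S and y into T, and colour the edges at x greedily.
-- If this fails at z, then S is N(z) for δ = 1 and N(z) ∪ {z} for δ = 2, while δ ≥ 3 contradicts
-- δ · deg z < |V|, which holds as there are no cycles of length 3 and 4.
module Submission where

open import Defs hiding (sym)
open import Data.Nat using (ℕ; ⌈_/2⌉)
open import Relation.Nullary using (¬_)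

open import Algebra.Bundles using (CommutativeMonoid)
import Algebra.Properties.CommutativeSemigroup as CommutativeSemigroupProperties
open import Data.Bool as Bool using (true; false; if_then_else_)
import Data.Bool.Properties as Bool
open import Data.Empty using (⊥; ⊥-elim)
open import Data.Fin as Fin using (Fin; toℕ; inject≤)
open import Data.Fin.Patterns using (0F; 1F; 2F; 3F; 4F)
import Data.Fin.Properties as Fin
open import Data.List
  using (List; []; _∷_; [_]; _++_; length; lookup; map; filter; concatMap; allFin)
open import Data.List.Extrema.Nat using (argmin; argmin-sel; f[argmin]≤f[xs])
open import Data.List.Properties
  using (length-++; length-map; length-tabulate; filter-++; filter-accept; filter-reject)
open import Data.List.Membership.Propositional using (_∈_; _∉_; find; lose)
open import Data.List.Membership.Propositional.Properties
  using (∈-∃++; ∈-++⁺ˡ; ∈-++⁺ʳ; ∈-++⁻; ∈-map⁺; ∈-filter⁺; ∈-filter⁻; ∈-concatMap⁻; ∈-lookup)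
import Data.List.Membership.DecPropositional as DecMembership
open import Data.List.Relation.Binary.Permutation.Propositional
  using (_↭_; ↭-refl; ↭-sym; ↭-trans; prep; ↭⇒↭ₛ)
open import Data.List.Relation.Binary.Permutation.Propositional.Properties
  using (shift; ∈-resp-↭; ↭-length; filter-↭; ++⁺ˡ; ++⁺ʳ; ++-commutativeMonoid)
  renaming (++-comm to ++-↭-comm; ++-assoc to ++-↭-assoc)
import Data.List.Relation.Binary.Permutation.Setoid.Properties as PermutationSetoid
open import Data.List.Relation.Binary.Subset.Propositional using (_⊆_)
open import Data.List.Relation.Unary.All as All using (All; []; _∷_)
import Data.List.Relation.Unary.All.Properties as AllProperties
open import Data.List.Relation.Unary.AllPairs as AllPairs using ([]; _∷_)
open import Data.List.Relation.Unary.Any using (Any; here; there; any?)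
open import Data.List.Relation.Unary.Linked using ([-]; _∷_)
open import Data.List.Relation.Unary.Unique.Propositional using (Unique)
import Data.List.Relation.Unary.Unique.Propositional.Properties as Unique
open import Data.Nat using (zero; suc; _+_; _*_; _∸_; _≤_; _<_; z≤n; s≤s; s≤s⁻¹; _≤?_)
open import Data.Nat.Properties hiding (_≟_)
open import Data.Nat.Tactic.RingSolver using (solve-∀)
open import Data.Product using (∃; _×_; _,_; proj₁; proj₂; swap)
open import Data.Sum as Sum using (_⊎_; inj₁; inj₂; [_,_]′)
open import Function using (_∘_)
open import Function.Definitions using (Injective)
open import Relation.Binary.Definitions using (DecidableEquality)
open import Relation.Binary.PropositionalEquality
  using (_≡_; _≢_; refl; sym; trans; cong; cong₂; subst; subst₂; setoid; ≢-sym)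
open import Relation.Nullary using (Dec; yes; no; does; contradiction; ¬?)
open import Relation.Nullary.Decidable using (decidable-stable; toWitness; _×-dec_; _→-dec_)
open import Relation.Unary using (Decidable)

open ≤-Reasoning

-- Lists without repetition, permutations and minimisers.

∈⇒↭-∷ : ∀ {A : Set} {x : A} {xs} → x ∈ xs → ∃ λ ys → xs ↭ x ∷ ys
∈⇒↭-∷ x∈xs with ys , zs , refl ← ∈-∃++ x∈xs = ys ++ zs , shift _ ys zs

∈-∷⁻ : ∀ {A : Set} {x v : A} {xs} → v ∈ x ∷ xs → v ≢ x → v ∈ xs
∈-∷⁻ (here v≡x)   v≢x = contradiction v≡x v≢x
∈-∷⁻ (there v∈xs) _   = v∈xs

Unique-⊆⇒length-≤ : ∀ {A : Set} {xs ys : List A} → Unique xs → xs ⊆ ys → length xs ≤ length ys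
Unique-⊆⇒length-≤ []         _     = z≤n
Unique-⊆⇒length-≤ (x∉xs ∷ u) xs⊆ys with zs , ys↭ ← ∈⇒↭-∷ (xs⊆ys (here refl)) =
  ≤-trans
    (s≤s (Unique-⊆⇒length-≤ u λ v∈xs →
      ∈-∷⁻ (∈-resp-↭ ys↭ (xs⊆ys (there v∈xs))) (≢-sym (All.lookup x∉xs v∈xs))))
    (≤-reflexive (sym (↭-length ys↭)))

Unique-resp-↭ : ∀ {A : Set} {xs ys : List A} → xs ↭ ys → Unique xs → Unique ys
Unique-resp-↭ = PermutationSetoid.Unique-resp-↭ (setoid _) ∘ ↭⇒↭ₛ

Unique-++⁻ : ∀ {A : Set} (xs {ys} : List A) → Unique (xs ++ ys) → Unique xs × Unique ys
Unique-++⁻ []       ys!          = [] , ys!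
Unique-++⁻ (x ∷ xs) (x∉ ∷ xsys!) =
  let xs! , ys! = Unique-++⁻ xs xsys! in AllProperties.++⁻ˡ xs x∉ ∷ xs! , ys!

Unique-++⇒disjoint : ∀ {A : Set} (xs {ys} : List A) → Unique (xs ++ ys) → ∀ {v} → v ∈ xs → v ∉ ys
Unique-++⇒disjoint (x ∷ xs) (x∉ ∷ _)    (here refl)  v∈ys = All.lookup x∉ (∈-++⁺ʳ xs v∈ys) refl
Unique-++⇒disjoint (x ∷ xs) (_ ∷ xsys!) (there v∈xs) v∈ys = Unique-++⇒disjoint xs xsys! v∈xs v∈ys

filter-↭-split : ∀ {A : Set} {P : A → Set} (P? : Decidable P) (xs : List A) →
  xs ↭ filter P? xs ++ filter (¬? ∘ P?) xs
filter-↭-split P? []       = ↭-refl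
filter-↭-split P? (x ∷ xs) with does (P? x)
... | true  = prep x (filter-↭-split P? xs)
... | false = ↭-trans (prep x (filter-↭-split P? xs)) (↭-sym (shift x (filter P? xs) _))

++-↭-interchange : ∀ {A : Set} (ws xs ys zs : List A) →
  (ws ++ xs) ++ (ys ++ zs) ↭ (ws ++ ys) ++ (xs ++ zs)
++-↭-interchange {A} = CommutativeSemigroupProperties.interchange
  (CommutativeMonoid.commutativeSemigroup (++-commutativeMonoid {A = A}))

minimiser : ∀ {A : Set} (f : A → ℕ) {x : A} {xs} → x ∈ xs → ∃ λ m → m ∈ xs × (∀ {v} → v ∈ xs → f m ≤ f v)
minimiser f {x} {xs} x∈xs =
  argmin f x xs ,
  [ (λ eq → subst (_∈ xs) (sym eq) x∈xs) , (λ m∈xs → m∈xs) ]′ (argmin-sel f x xs) ,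
  All.lookup (f[argmin]≤f[xs] x xs)

InjectiveOn : ∀ {A : Set} → List A → (A → A) → Set
InjectiveOn xs f = ∀ {x y} → x ∈ xs → y ∈ xs → f x ≡ f y → x ≡ y

-- Choice functions, distinct representatives and derangements on a list.

module ListChoice {A : Set} (_≟_ : DecidableEquality A) where

  open DecMembership _≟_ using (_∈?_)

  _[_↦_] : (A → A) → A → A → A → A
  (f [ x ↦ t ]) u = if does (u ≟ x) then t else f u

  update-≡ : ∀ f x t → (f [ x ↦ t ]) x ≡ t
  update-≡ f x t with x ≟ x
  ... | yes _  = refl
  ... | no x≢x = contradiction refl x≢x

  update-≢ : ∀ f {x t u} → u ≢ x → (f [ x ↦ t ]) u ≡ f u
  update-≢ f {x} {t} {u} u≢x with u ≟ x
  ... | yes u≡x = contradiction u≡x u≢x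
  ... | no _    = refl

  choice : (P : A → A → Set) (xs : List A) → (∀ {x} → x ∈ xs → ∃ (P x)) →
    ∃ λ f → ∀ {x} → x ∈ xs → P x (f x)
  -- Off the list the values are immaterial; the identity serves as default.
  choice P []       _  = (λ x → x) , λ ()
  choice P (x ∷ xs) ex
    with t , pt ← ex (here refl)
       | f , pf ← choice P xs (ex ∘ there) = f [ x ↦ t ] , ok _
    where
    ok : ∀ u → u ∈ x ∷ xs → P u ((f [ x ↦ t ]) u)
    ok u u∈ with u ≟ x
    ... | yes refl = pt
    ... | no u≢x   = pf (∈-∷⁻ u∈ u≢x)

  avoid : ∀ {T F : List A} → Unique T → length F < length T → ∃ λ t → t ∈ T × t ∉ F
  avoid {T} {F} T! F<T with any? (λ t → ¬? (t ∈? F)) T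
  ... | yes p = find p
  ... | no ¬p = contradiction (Unique-⊆⇒length-≤ T! λ {t} t∈T →
      decidable-stable (t ∈? F) λ t∉F → ¬p (lose t∈T t∉F)) (<⇒≱ F<T)

  -- The head `z` has to avoid `F z` and the representatives already given to the tail. Since `z`
  -- itself counts in `length zs`, the bound makes these fewer than the members of `T`.
  greedyRepresentatives : ∀ {T} → Unique T → (F : A → List A) (zs : List A) → Unique zs →
    (∀ {z} → z ∈ zs → length (F z) + length zs ≤ length T) →
    ∃ λ f → (∀ {z} → z ∈ zs → f z ∈ T × f z ∉ F z) × InjectiveOn zs f
  greedyRepresentatives T! F []       _            _     = (λ z → z) , (λ ()) , λ ()
  greedyRepresentatives {T} T! F (z ∷ zs) (z∉zs ∷ zs!) bound
    with f , f-ok , f-inj ← greedyRepresentatives T! F zs zs!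
           (λ z∈ → ≤-trans (+-monoʳ-≤ _ (n≤1+n _)) (bound (there z∈)))
    with t , t∈T , t∉ ← avoid {F = F z ++ map f zs} T! (begin-strict
           length (F z ++ map f zs)       ≡⟨ length-++ (F z) ⟩
           length (F z) + length (map f zs) ≡⟨ cong (length (F z) +_) (length-map f zs) ⟩
           length (F z) + length zs       <⟨ +-monoʳ-< (length (F z)) (n<1+n _) ⟩
           length (F z) + suc (length zs) ≤⟨ bound (here refl) ⟩
           length T                       ∎)
    = f [ z ↦ t ] , ok _ , inj _ _
    where

    ok : ∀ u → u ∈ z ∷ zs → (f [ z ↦ t ]) u ∈ T × (f [ z ↦ t ]) u ∉ F u
    ok u u∈ with u ≟ z
    ... | yes refl = t∈T , t∉ ∘ ∈-++⁺ˡ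
    ... | no u≢z   = f-ok (∈-∷⁻ u∈ u≢z)
    fresh : ∀ {u} → u ∈ zs → f u ≢ t
    fresh u∈zs fu≡t = t∉ (∈-++⁺ʳ (F z) (subst (_∈ map f zs) fu≡t (∈-map⁺ f u∈zs)))
    inj : ∀ u v → u ∈ z ∷ zs → v ∈ z ∷ zs → (f [ z ↦ t ]) u ≡ (f [ z ↦ t ]) v → u ≡ v
    inj u v u∈ v∈ eq with u ≟ z | v ≟ z
    ... | yes refl | yes refl = refl
    ... | yes refl | no v≢z   = contradiction (sym eq) (fresh (∈-∷⁻ v∈ v≢z))
    ... | no u≢z   | yes refl = contradiction eq (fresh (∈-∷⁻ u∈ u≢z))
    ... | no u≢z   | no v≢z   = f-inj (∈-∷⁻ u∈ u≢z) (∈-∷⁻ v∈ v≢z) eq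

  derangement : ∀ {xs} → Unique xs → 2 ≤ length xs →
    ∃ λ σ → (∀ {x} → x ∈ xs → σ x ∈ xs × σ x ≢ x) × InjectiveOn xs σ
  derangement {x ∷ []} _ (s≤s ())
  derangement {x ∷ y ∷ []} ((x≢y ∷ []) ∷ _) _ = σ , ok , inj
    where
    σ = (λ _ → x) [ x ↦ y ]
    σx : σ x ≡ y
    σx = update-≡ (λ _ → x) x y
    σy : σ y ≡ x
    σy = update-≢ (λ _ → x) (≢-sym x≢y)
    ok : ∀ {u} → u ∈ x ∷ y ∷ [] → σ u ∈ x ∷ y ∷ [] × σ u ≢ u
    ok (here refl)         rewrite σx = there (here refl) , ≢-sym x≢y
    ok (there (here refl)) rewrite σy = here refl , x≢y
    inj : InjectiveOn (x ∷ y ∷ []) σ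
    inj (here refl) (here refl) _ = refl
    inj (here refl) (there (here refl)) eq = contradiction (trans (sym σy) (trans (sym eq) σx)) x≢y
    inj (there (here refl)) (here refl) eq = contradiction (trans (sym σy) (trans eq σx)) x≢y
    inj (there (here refl)) (there (here refl)) _ = refl
  -- Inserts x into the cycle of σ between y and σ y.
  derangement {x ∷ xs@(y ∷ _ ∷ _)} (x∉xs ∷ xs!) _
    with σ , σ-ok , σ-inj ← derangement xs! (s≤s (s≤s z≤n)) = σ′ , ok _ , inj _ _
    where
    σ′ = (σ [ y ↦ x ]) [ x ↦ σ y ]
    ok : ∀ u → u ∈ x ∷ xs → σ′ u ∈ x ∷ xs × σ′ u ≢ u
    ok u u∈ with u ≟ x
    ... | yes refl = there (proj₁ (σ-ok (here refl))) , ≢-sym (All.lookup x∉xs (proj₁ (σ-ok (here refl))))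
    ... | no u≢x with u ≟ y
    ...   | yes refl = here refl , ≢-sym u≢x
    ...   | no u≢y   = there (proj₁ (σ-ok (∈-∷⁻ u∈ u≢x))) , proj₂ (σ-ok (∈-∷⁻ u∈ u≢x))
    σ≢x : ∀ {u} → u ∈ xs → σ u ≢ x
    σ≢x u∈ eq = All.lookup x∉xs (proj₁ (σ-ok u∈)) (sym eq)
    inj : ∀ u v → u ∈ x ∷ xs → v ∈ x ∷ xs → σ′ u ≡ σ′ v → u ≡ v
    inj u v u∈ v∈ eq with u ≟ x | v ≟ x
    ... | yes refl | yes refl = refl
    ... | yes refl | no v≢x with v ≟ y
    ...   | yes refl = contradiction eq (σ≢x (here refl))
    ...   | no v≢y   = contradiction (sym (σ-inj (here refl) (∈-∷⁻ v∈ v≢x) eq)) v≢y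
    inj u v u∈ v∈ eq | no u≢x | yes refl with u ≟ y
    ...   | yes refl = contradiction (sym eq) (σ≢x (here refl))
    ...   | no u≢y   = contradiction (σ-inj (∈-∷⁻ u∈ u≢x) (here refl) eq) u≢y
    inj u v u∈ v∈ eq | no u≢x | no v≢x with u ≟ y | v ≟ y
    ...   | yes refl | yes refl = refl
    ...   | yes refl | no v≢y   = contradiction (sym eq) (σ≢x (∈-∷⁻ v∈ v≢x))
    ...   | no u≢y   | yes refl = contradiction eq (σ≢x (∈-∷⁻ u∈ u≢x))
    ...   | no u≢y   | no v≢y   = σ-inj (∈-∷⁻ u∈ u≢x) (∈-∷⁻ v∈ v≢x) eq

-- The triangle-free graph `H`: neighbourhoods, colourings and splits.

module Splitting {A : Set} (_≟_ : DecidableEquality A)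
  (H : A → A → Set) (H? : ∀ u v → Dec (H u v)) (H-sym : ∀ {u v} → H u v → H v u)
  (triangle-free : ∀ {u v w} → H u v → H v w → ¬ H u w)
  (c4-twins : ∀ {p q r s w} → p ≢ r → q ≢ s → H p q → H q r → H r s → H s p → H w p → H w r)
  where

  open ListChoice _≟_

  H-irrefl : ∀ {u} → ¬ H u u
  H-irrefl h = triangle-free h h h

  nbrs : List A → A → List A
  nbrs V x = filter (H? x) V

  deg : List A → A → ℕ
  deg V x = length (nbrs V x)

  ∈-nbrs⁺ : ∀ {V x v} → v ∈ V → H x v → v ∈ nbrs V x
  ∈-nbrs⁺ = ∈-filter⁺ (H? _)

  ∈-nbrs⁻ : ∀ V {x v} → v ∈ nbrs V x → v ∈ V × H x v
  ∈-nbrs⁻ _ = ∈-filter⁻ (H? _)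

  deg-++ : ∀ U V x → deg (U ++ V) x ≡ deg U x + deg V x
  deg-++ U V x = trans (cong length (filter-++ (H? x) U V)) (length-++ (nbrs U x))

  deg-↭ : ∀ {U V} → U ↭ V → ∀ x → deg U x ≡ deg V x
  deg-↭ U↭V x = ↭-length (filter-↭ (H? x) U↭V)

  deg-∷ : ∀ {x u} V → H u x → deg (x ∷ V) u ≡ suc (deg V u)
  deg-∷ V h = cong length (filter-accept (H? _) h)

  deg-∷-self : ∀ x V → deg (x ∷ V) x ≡ deg V x
  deg-∷-self x V = cong length (filter-reject (H? _) H-irrefl)

  -- For an H-edge uv inside S, the vertex colour u v ∈ T is the midpoint of the path joining u to v.
  record Colouring (S T : List A) : Set where
    field
      colour      : A → A → A
      colour-sym  : ∀ {u v} → u ∈ S → v ∈ S → H u v → colour u v ≡ colour v u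
      colour-∈    : ∀ {u v} → u ∈ S → v ∈ S → H u v → colour u v ∈ T
      colour-free : ∀ {u v} → u ∈ S → v ∈ S → H u v → ¬ H u (colour u v)
      colour-inj  : ∀ {u v w} → u ∈ S → v ∈ S → w ∈ S → H u v → H u w →
                    colour u v ≡ colour u w → v ≡ w

  open Colouring

  -- `S` will hold the branch vertices and `T` the midpoints. The bound `T≤S` yields enough branch
  -- vertices, while `S≤1+T` keeps enough colours in `T` for the greedy colouring in `extendSplit`.
  record Split (V : List A) : Set where
    field
      S T       : List A
      perm      : V ↭ S ++ T
      T≤S       : length T ≤ length S
      S≤1+T     : length S ≤ suc (length T)
      colouring : Colouring S T

  -- Only H-edges inside the vertex set are constrained. Hence `S′` may even exceed `S`, as long as
  -- its new vertices lie on no H-edge inside `S′`; independent sets and bicliques are treated in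
  -- this way.
  restrict : ∀ {S T S′ T′} → Colouring S T →
    (∀ {u v} → u ∈ S′ → v ∈ S′ → H u v → u ∈ S × v ∈ S) → T ⊆ T′ → Colouring S′ T′
  restrict C edge⊆ T⊆T′ = record
    { colour      = colour C
    ; colour-sym  = λ u∈ v∈ h → let u∈S , v∈S = edge⊆ u∈ v∈ h in colour-sym C u∈S v∈S h
    ; colour-∈    = λ u∈ v∈ h → let u∈S , v∈S = edge⊆ u∈ v∈ h in T⊆T′ (colour-∈ C u∈S v∈S h)
    ; colour-free = λ u∈ v∈ h → let u∈S , v∈S = edge⊆ u∈ v∈ h in colour-free C u∈S v∈S h
    ; colour-inj  = λ u∈ v∈ w∈ h k → let u∈S , v∈S = edge⊆ u∈ v∈ h ; _ , w∈S = edge⊆ u∈ w∈ k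
                    in colour-inj C u∈S v∈S w∈S h k
    }

  independentColouring : ∀ {S T} → (∀ {u v} → u ∈ S → v ∈ S → ¬ H u v) → Colouring S T
  independentColouring {T = T} indep = restrict {S = []} {T = T} record
    { colour      = λ u _ → u
    ; colour-sym  = λ ()
    ; colour-∈    = λ ()
    ; colour-free = λ ()
    ; colour-inj  = λ ()
    } (λ u∈ v∈ h → contradiction h (indep u∈ v∈)) (λ t∈T → t∈T)

  nbrs-independent : ∀ V {x u v} → u ∈ nbrs V x → v ∈ nbrs V x → ¬ H u v
  nbrs-independent V u∈ v∈ h = triangle-free (proj₂ (∈-nbrs⁻ V u∈)) h (proj₂ (∈-nbrs⁻ V v∈))

  -- Old H-edges keep their colours and the edge `x z` gets `f z`. Two edges with a common end are
  -- both old, both at `x`, or of the form `x z` and `z v`, so the last two hypotheses exclude every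
  -- new clash.
  addVertex : ∀ {S T} (C : Colouring S T) (x : A) (f : A → A) →
    (∀ {z} → z ∈ S → H x z → f z ∈ T × ¬ H x (f z) × ¬ H z (f z)) →
    (∀ {z z′} → z ∈ S → z′ ∈ S → H x z → H x z′ → f z ≡ f z′ → z ≡ z′) →
    (∀ {z v} → z ∈ S → v ∈ S → H x z → H z v → colour C z v ≢ f z) →
    Colouring (x ∷ S) T
  addVertex {S} {T} C x f f-ok f-inj f-new = record
    { colour      = c
    ; colour-sym  = c-sym _ _
    ; colour-∈    = λ u∈ v∈ h → proj₁ (c-ok _ _ u∈ v∈ h)
    ; colour-free = λ u∈ v∈ h → proj₂ (c-ok _ _ u∈ v∈ h)
    ; colour-inj  = c-inj _ _ _
    }
    where
    c : A → A → A
    c u v = if does (u ≟ x) then f v else if does (v ≟ x) then f u else colour C u v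
    c-sym : ∀ u v → u ∈ x ∷ S → v ∈ x ∷ S → H u v → c u v ≡ c v u
    c-sym u v u∈ v∈ h with u ≟ x | v ≟ x
    ... | yes refl | yes refl = refl
    ... | yes refl | no _     = refl
    ... | no _     | yes refl = refl
    ... | no u≢x   | no v≢x   = colour-sym C (∈-∷⁻ u∈ u≢x) (∈-∷⁻ v∈ v≢x) h
    c-ok : ∀ u v → u ∈ x ∷ S → v ∈ x ∷ S → H u v → c u v ∈ T × ¬ H u (c u v)
    c-ok u v u∈ v∈ h with u ≟ x | v ≟ x
    ... | yes refl | yes refl = contradiction h H-irrefl
    ... | yes refl | no v≢x   =
      let t∈T , x-free , _ = f-ok (∈-∷⁻ v∈ v≢x) h in t∈T , x-free
    ... | no u≢x   | yes refl =
      let t∈T , _ , u-free = f-ok (∈-∷⁻ u∈ u≢x) (H-sym h) in t∈T , u-free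
    ... | no u≢x   | no v≢x   =
      colour-∈ C (∈-∷⁻ u∈ u≢x) (∈-∷⁻ v∈ v≢x) h , colour-free C (∈-∷⁻ u∈ u≢x) (∈-∷⁻ v∈ v≢x) h
    c-inj : ∀ u v w → u ∈ x ∷ S → v ∈ x ∷ S → w ∈ x ∷ S → H u v → H u w → c u v ≡ c u w → v ≡ w
    c-inj u v w u∈ v∈ w∈ h k eq with u ≟ x | v ≟ x | w ≟ x
    ... | yes refl | yes refl | _        = contradiction h H-irrefl
    ... | yes refl | no _     | yes refl = contradiction k H-irrefl
    ... | yes refl | no v≢x   | no w≢x   = f-inj (∈-∷⁻ v∈ v≢x) (∈-∷⁻ w∈ w≢x) h k eq
    ... | no _     | yes refl | yes refl = refl
    ... | no u≢x   | yes refl | no w≢x   =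
      contradiction (sym eq) (f-new (∈-∷⁻ u∈ u≢x) (∈-∷⁻ w∈ w≢x) (H-sym h) k)
    ... | no u≢x   | no v≢x   | yes refl =
      contradiction eq (f-new (∈-∷⁻ u∈ u≢x) (∈-∷⁻ v∈ v≢x) (H-sym k) h)
    ... | no u≢x   | no v≢x   | no w≢x   =
      colour-inj C (∈-∷⁻ u∈ u≢x) (∈-∷⁻ v∈ v≢x) (∈-∷⁻ w∈ w≢x) h k eq

  -- Moving a vertex from `S` to `T` leaves fewer H-edges to colour and one more colour to use. It
  -- is done only while `S` is longer than `T` by at least two, so `T` never overtakes `S`.
  balance : ∀ {V} S T → V ↭ S ++ T → length T ≤ length S → Colouring S T → Split V
  balance S T V↭ T≤S C with length S ≤? suc (length T)
  ... | yes S≤1+T = record { S = S ; T = T ; perm = V↭ ; T≤S = T≤S ; S≤1+T = S≤1+T ; colouring = C }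
  balance []      T V↭ T≤S C | no S≰1+T = contradiction z≤n S≰1+T
  balance (s ∷ S) T V↭ T≤S C | no S≰1+T =
    balance S (s ∷ T) (↭-trans V↭ (↭-sym (shift s S T))) (s≤s⁻¹ (≰⇒> S≰1+T))
      (restrict C (λ u∈ v∈ _ → there u∈ , there v∈) there)

  non-nbrs : List A → A → List A
  non-nbrs V x = filter (¬? ∘ H? x) V

  -- As `H` is triangle-free, a neighbourhood in `H` is a clique of the complement, so no midpoints
  -- are required when it covers half of `V`.
  cliqueSplit : ∀ V z → length V ≤ 2 * deg V z → Split V
  cliqueSplit V z V≤2d = balance (nbrs V z) (non-nbrs V z) V↭ (+-cancelˡ-≤ (deg V z) _ _ (begin
      deg V z + length (non-nbrs V z)          ≡⟨ length-++ (nbrs V z) ⟨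
      length (nbrs V z ++ non-nbrs V z)        ≡⟨ ↭-length V↭ ⟨
      length V                                 ≤⟨ V≤2d ⟩
      2 * deg V z                              ≡⟨ cong (deg V z +_) (+-identityʳ _) ⟩
      deg V z + deg V z                        ∎))
    (independentColouring (nbrs-independent V))
    where
    V↭ = filter-↭-split (H? z) V

  -- The case of a 4-cycle.

  rest : List A → A → A → List A
  rest V a b = non-nbrs (non-nbrs V a) b

  -- The component of the 4-cycle is complete bipartite with sides N(b) ∋ a and N(a) ∋ b: both sides are
  -- independent and no H-edge leaves them, so the larger side joins S and the smaller one joins T.
  bicliqueSplit : ∀ V {a b a′ b′} → a′ ∈ V → a ≢ a′ → b ≢ b′ →
    H a b → H b a′ → H a′ b′ → H b′ a → Split (rest V a b) → Split V
  bicliqueSplit V {a} {b} {a′} {b′} a′∈V a≢a′ b≢b′ ab ba′ a′b′ b′a R =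
    [ (λ Y≤X → balance (X ++ S) (Y ++ T)
        (↭-trans V↭ (↭-trans (swapSides Y X (S ++ T)) (++-↭-interchange X Y S T)))
        (lengths Y X Y≤X) (extendBy X X-indep X-closed (∈-++⁺ʳ Y)))
    , (λ X≤Y → balance (Y ++ S) (X ++ T)
        (↭-trans V↭ (++-↭-interchange Y X S T))
        (lengths X Y X≤Y) (extendBy Y Y-indep Y-closed (∈-++⁺ʳ X)))
    ]′ (≤-total (length Y) (length X))
    where
    open Split R renaming (perm to R↭)
    Y = nbrs V a
    X = nbrs (non-nbrs V a) b
    V↭ : V ↭ (Y ++ X) ++ (S ++ T)
    V↭ = ↭-trans (filter-↭-split (H? a) V)
        (↭-trans (++⁺ˡ Y (↭-trans (filter-↭-split (H? b) (non-nbrs V a)) (++⁺ˡ X R↭)))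
          (↭-sym (++-↭-assoc Y X (S ++ T))))
    swapSides : ∀ (xs ys zs : List A) → (xs ++ ys) ++ zs ↭ (ys ++ xs) ++ zs
    swapSides xs ys zs = ++⁺ʳ zs (++-↭-comm xs ys)
    lengths : ∀ (xs ys : List A) → length xs ≤ length ys → length (xs ++ T) ≤ length (ys ++ S)
    lengths xs ys xs≤ys rewrite length-++ xs {T} | length-++ ys {S} = +-mono-≤ xs≤ys T≤S
    S⁻ : ∀ {s} → s ∈ S → s ∈ V × ¬ H a s × ¬ H b s
    S⁻ s∈S =
      let s∈ , ¬bs = ∈-filter⁻ (¬? ∘ H? b) (∈-resp-↭ (↭-sym R↭) (∈-++⁺ˡ s∈S))
          s∈V , ¬as = ∈-filter⁻ (¬? ∘ H? a) s∈
      in s∈V , ¬as , ¬bs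
    X-indep : ∀ {u v} → u ∈ X → v ∈ X → ¬ H u v
    X-indep = nbrs-independent (non-nbrs V a)
    Y-indep : ∀ {u v} → u ∈ Y → v ∈ Y → ¬ H u v
    Y-indep = nbrs-independent V
    X-closed : ∀ {x s} → x ∈ X → s ∈ S → ¬ H x s
    X-closed {x} x∈X s∈S xs with _ , bx ← ∈-nbrs⁻ (non-nbrs V a) x∈X | x ≟ a
    ... | yes refl = proj₁ (proj₂ (S⁻ s∈S)) xs
    -- By `b′x` there is a 4-cycle `x`, `b`, `a`, `b′` with `x` opposite to `a`, so the H-neighbour
    -- `s` of `x` would be one of `a`. `Y-closed` is the same argument with the sides exchanged.
    ... | no x≢a   = proj₁ (proj₂ (S⁻ s∈S)) (H-sym
          (c4-twins x≢a b≢b′ (H-sym bx) (H-sym ab) (H-sym b′a) b′x (H-sym xs)))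
      where
      b′x : H b′ x
      b′x = H-sym (c4-twins b≢b′ (≢-sym a≢a′) ba′ a′b′ b′a ab (H-sym bx))
    Y-closed : ∀ {y s} → y ∈ Y → s ∈ S → ¬ H y s
    Y-closed {y} y∈Y s∈S ys with _ , ay ← ∈-nbrs⁻ V y∈Y | y ≟ b
    ... | yes refl = proj₂ (proj₂ (S⁻ s∈S)) ys
    ... | no y≢b   = proj₂ (proj₂ (S⁻ s∈S)) (H-sym
          (c4-twins y≢b a≢a′ (H-sym ay) ab ba′ a′y (H-sym ys)))
      where
      a′y : H a′ y
      a′y = H-sym (c4-twins a≢a′ b≢b′ ab ba′ a′b′ b′a (H-sym ay))
    extendBy : ∀ Z → (∀ {u v} → u ∈ Z → v ∈ Z → ¬ H u v) → (∀ {z s} → z ∈ Z → s ∈ S → ¬ H z s) →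
      ∀ {T′} → T ⊆ T′ → Colouring (Z ++ S) T′
    extendBy Z indep closed = restrict colouring λ u∈ v∈ h → edge h (∈-++⁻ Z u∈) (∈-++⁻ Z v∈)
      where
      edge : ∀ {u v} → H u v → _ → _ → u ∈ S × v ∈ S
      edge h (inj₁ u∈Z) (inj₁ v∈Z) = contradiction h (indep u∈Z v∈Z)
      edge h (inj₁ u∈Z) (inj₂ v∈S) = contradiction h (closed u∈Z v∈S)
      edge h (inj₂ u∈S) (inj₁ v∈Z) = contradiction (H-sym h) (closed v∈Z u∈S)
      edge h (inj₂ u∈S) (inj₂ v∈S) = u∈S , v∈S

  -- Large neighbourhoods and degree bounds in the absence of 4-cycles.

  C4-free : List A → Set
  C4-free V = ∀ {p q r s} → p ∈ V → q ∈ V → r ∈ V → s ∈ V → p ≢ r → q ≢ s →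
    H p q → H q r → H r s → ¬ H s p

  otherNbr : ∀ V {z w} → Unique V → (∀ {w} → w ∈ V → H z w → 2 ≤ deg V w) → w ∈ nbrs V z →
    ∃ λ t → t ∈ V × H w t × t ≢ z
  otherNbr V {z} V! 2≤deg w∈N =
    let w∈V , zw = ∈-nbrs⁻ V w∈N
        t , t∈ , t∉ = avoid {F = [ z ]} (Unique.filter⁺ (H? _) V!) (2≤deg w∈V zw)
        t∈V , wt = ∈-nbrs⁻ V t∈
    in t , t∈V , wt , t∉ ∘ here

  -- S is the closed neighbourhood of z. The H-edge from z to w gets as its colour a second neighbour
  -- of z behind σ w ≠ w, which is not H-adjacent to w since there is no 4-cycle.
  starSplit : ∀ V {z} → C4-free V → Unique V → z ∈ V → 2 ≤ deg V z →
    (∀ {w} → w ∈ V → H z w → 2 ≤ deg V w) → length V ≤ suc (2 * deg V z) → Split V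
  starSplit V {z} c4-free V! z∈V 2≤d 2≤deg V≤
    with T , R↭ ← ∈⇒↭-∷ (∈-filter⁺ (¬? ∘ H? z) z∈V H-irrefl)
       | σ , σ-ok , σ-inj ← derangement (Unique.filter⁺ (H? z) V!) 2≤d
       | g , g-ok ← choice (λ w t → t ∈ V × H w t × t ≢ z) (nbrs V z) (otherNbr V V! 2≤deg)
    = balance (z ∷ nbrs V z) T V↭ T≤S
        -- All H-edges inside the closed neighbourhood are at `z`, so an empty colouring is extended
        -- and no clash can occur at a neighbour of `z`.
        (addVertex (independentColouring (nbrs-independent V)) z (g ∘ σ)
          (λ w∈N _ → f-ok w∈N) (λ w∈N w′∈N _ _ → f-inj w∈N w′∈N)
          (λ w∈N v∈N _ wv → contradiction wv (nbrs-independent V w∈N v∈N)))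
    where
    V↭ : V ↭ (z ∷ nbrs V z) ++ T
    V↭ = ↭-trans (filter-↭-split (H? z) V) (↭-trans (++⁺ˡ (nbrs V z) R↭) (shift z (nbrs V z) T))
    T≤S : length T ≤ suc (deg V z)
    T≤S = +-cancelˡ-≤ (deg V z) _ _ (s≤s⁻¹ (begin
      suc (deg V z + length T)            ≡⟨ length-++ (z ∷ nbrs V z) ⟨
      length ((z ∷ nbrs V z) ++ T)        ≡⟨ ↭-length V↭ ⟨
      length V                            ≤⟨ V≤ ⟩
      suc (2 * deg V z)                   ≤⟨ n≤1+n _ ⟩
      suc (suc (2 * deg V z))             ≡⟨ arith (deg V z) ⟩
      suc (deg V z + suc (deg V z))       ∎))
      where
      arith : ∀ d → suc (suc (2 * d)) ≡ suc (d + suc d)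
      arith = solve-∀
    f-ok : ∀ {w} → w ∈ nbrs V z → g (σ w) ∈ T × ¬ H z (g (σ w)) × ¬ H w (g (σ w))
    f-ok {w} w∈N =
      let σw∈N , σw≢w = σ-ok w∈N
          w∈V , zw = ∈-nbrs⁻ V w∈N
          σw∈V , zσw = ∈-nbrs⁻ V σw∈N
          t∈V , σwt , t≢z = g-ok σw∈N
          ¬zt = triangle-free zσw σwt
      in ∈-∷⁻ (∈-resp-↭ R↭ (∈-filter⁺ (¬? ∘ H? z) t∈V ¬zt)) t≢z , ¬zt ,
         λ wt → c4-free z∈V w∈V t∈V σw∈V (≢-sym t≢z) (≢-sym σw≢w) zw wt (H-sym σwt) (H-sym zσw)
    f-inj : InjectiveOn (nbrs V z) (g ∘ σ)
    f-inj {w} {w′} w∈N w′∈N eq with σ w ≟ σ w′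
    ... | yes σ≡ = σ-inj w∈N w′∈N σ≡
    -- A common second neighbour `t` behind different `σ w` and `σ w′` would close the 4-cycle `z`,
    -- `σ w`, `t`, `σ w′`.
    ... | no σ≢  =
      let σw∈V , zσw = ∈-nbrs⁻ V (proj₁ (σ-ok w∈N))
          σw′∈V , zσw′ = ∈-nbrs⁻ V (proj₁ (σ-ok w′∈N))
          t∈V , σwt , t≢z = g-ok (proj₁ (σ-ok w∈N))
          _ , σw′t′ , _ = g-ok (proj₁ (σ-ok w′∈N))
      in ⊥-elim (c4-free z∈V σw∈V t∈V σw′∈V (≢-sym t≢z) σ≢ zσw σwt
           (H-sym (subst (H (σ w′)) (sym eq) σw′t′)) (H-sym zσw′))

  -- The branches at z, each a neighbour w together with the neighbours of w other than z, are disjoint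
  -- and avoid z.
  minDegree*degree<length : ∀ V {δ z} → C4-free V → Unique V → z ∈ V →
    (∀ {w} → w ∈ V → δ ≤ deg V w) → deg V z * δ < length V
  minDegree*degree<length V {δ} {z} c4-free V! z∈V δ≤ =
    ≤-trans (s≤s (size (nbrs V z) (proj₁ ∘ N⁻)))
      (Unique-⊆⇒length-≤
        (All.tabulate (λ t∈ z≡t → z∉ (subst (_∈ _) (sym z≡t) t∈)) ∷
          branches! (nbrs V z) (Unique.filter⁺ (H? z) V!) N⁻)
        λ where
          (here refl) → z∈V
          (there t∈)  → branches⊆V t∈)
    where
    branch : A → List A
    branch w = w ∷ filter (λ v → ¬? (v ≟ z)) (nbrs V w)
    N⁻ : ∀ {w} → w ∈ nbrs V z → w ∈ V × H z w
    N⁻ = ∈-nbrs⁻ V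
    inner⁻ : ∀ w {t} → t ∈ filter (λ v → ¬? (v ≟ z)) (nbrs V w) → t ∈ V × H w t × t ≢ z
    inner⁻ w t∈ =
      let t∈N , t≢z = ∈-filter⁻ (λ v → ¬? (v ≟ z)) {xs = nbrs V w} t∈
          t∈V , wt = ∈-nbrs⁻ V t∈N
      in t∈V , wt , t≢z
    branches⁻ : ∀ ws {t} → t ∈ concatMap branch ws → ∃ λ w → w ∈ ws × t ∈ branch w
    branches⁻ ws t∈ = find (∈-concatMap⁻ branch {xs = ws} t∈)
    branches⊆V : concatMap branch (nbrs V z) ⊆ V
    branches⊆V t∈ with branches⁻ (nbrs V z) t∈
    ... | w , w∈N , here refl = proj₁ (N⁻ w∈N)
    ... | w , w∈N , there t∈w = proj₁ (inner⁻ w t∈w)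
    z∉ : z ∉ concatMap branch (nbrs V z)
    z∉ z∈ with branches⁻ (nbrs V z) z∈
    ... | w , w∈N , here refl = H-irrefl (proj₂ (N⁻ w∈N))
    ... | w , w∈N , there z∈w = proj₂ (proj₂ (inner⁻ w z∈w)) refl
    deg≤branch : ∀ w → deg V w ≤ length (branch w)
    -- The list `z ∷ _` contains all neighbours of `w` and is as long as `branch w`, where `w`
    -- stands in the place of `z`.
    deg≤branch w = Unique-⊆⇒length-≤ {ys = z ∷ _} (Unique.filter⁺ (H? w) V!) λ {t} t∈ → case t∈ (t ≟ z)
      where
      case : ∀ {t} → t ∈ nbrs V w → Dec (t ≡ z) → t ∈ z ∷ filter (λ v → ¬? (v ≟ z)) (nbrs V w)
      case t∈ (yes t≡z) = here t≡z
      case t∈ (no t≢z)  = there (∈-filter⁺ (λ v → ¬? (v ≟ z)) t∈ t≢z)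
    size : ∀ ws → (∀ {w} → w ∈ ws → w ∈ V) → length ws * δ ≤ length (concatMap branch ws)
    size []       _   = z≤n
    size (w ∷ ws) ⊆V = begin
      δ + length ws * δ
        ≤⟨ +-mono-≤ (≤-trans (δ≤ (⊆V (here refl))) (deg≤branch w)) (size ws (⊆V ∘ there)) ⟩
      length (branch w) + length (concatMap branch ws) ≡⟨ length-++ (branch w) ⟨
      length (branch w ++ concatMap branch ws)         ∎
    branch! : ∀ w → Unique (branch w)
    branch! w = All.tabulate (λ t∈ w≡t → H-irrefl (subst (H w) (sym w≡t) (proj₁ (proj₂ (inner⁻ w t∈)))))
      ∷ Unique.filter⁺ _ (Unique.filter⁺ (H? w) V!)
    -- If one of `w`, `w′` were in the other's branch, they would form a triangle with `z`; a common
    -- vertex `t` further out would give the 4-cycle `z`, `w`, `t`, `w′`.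
    disjoint : ∀ {w w′ t} → w ≢ w′ → w ∈ V × H z w → w′ ∈ V × H z w′ → t ∈ branch w → t ∉ branch w′
    disjoint w≢w′ _ _ (here refl) (here refl) = w≢w′ refl
    disjoint {w′ = w′} w≢w′ (_ , zw) (_ , zw′) (here refl) (there t∈) =
      triangle-free zw′ (proj₁ (proj₂ (inner⁻ w′ t∈))) zw
    disjoint {w} w≢w′ (_ , zw) (_ , zw′) (there t∈) (here refl) =
      triangle-free zw (proj₁ (proj₂ (inner⁻ w t∈))) zw′
    disjoint {w} {w′} w≢w′ (w∈V , zw) (w′∈V , zw′) (there t∈) (there t∈′) =
      let t∈V , wt , t≢z = inner⁻ w t∈
      in c4-free z∈V w∈V t∈V w′∈V (≢-sym t≢z) w≢w′ zw wt (H-sym (proj₁ (proj₂ (inner⁻ w′ t∈′)))) (H-sym zw′)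
    branches! : ∀ ws → Unique ws → (∀ {w} → w ∈ ws → w ∈ V × H z w) → Unique (concatMap branch ws)
    branches! []       _             _    = []
    branches! (w ∷ ws) (w∉ws ∷ ws!) ws⁻ =
      Unique.++⁺ (branch! w) (branches! ws ws! (ws⁻ ∘ there)) λ (t∈w , t∈ws) →
        let w′ , w′∈ws , t∈w′ = branches⁻ ws t∈ws
        in disjoint (All.lookup w∉ws w′∈ws) (ws⁻ (here refl)) (ws⁻ (there w′∈ws)) t∈w t∈w′

  -- Barred for the edge `x z` are the H-neighbours of `x` or `z` in `y ∷ T` and the colours at `z`
  -- inside `S`. Counted with multiplicity, and together with the `deg S x` edges to be coloured,
  -- they number `deg V x + deg V z` minus one, as `x` itself is a neighbour of `z`. By `bound` this
  -- is at most the number of colours in `y ∷ T`.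
  extendSplit : ∀ {V V′ x y} → Unique V → V ↭ x ∷ y ∷ V′ → Split V′ →
    (∀ {z} → z ∈ V → H x z → 2 * (deg V x + deg V z) ≤ 2 + length V) → Split V
  extendSplit {V} {V′} {x} {y} V! V↭xyV′
    record { S = S ; T = T ; perm = perm ; T≤S = T≤S ; S≤1+T = S≤1+T ; colouring = colouring } bound
    = record
      { S = x ∷ S ; T = y ∷ T ; perm = V↭ ; T≤S = s≤s T≤S ; S≤1+T = s≤s S≤1+T ; colouring = extended }
    where
    forbidden : A → List A
    forbidden z = nbrs (y ∷ T) x ++ nbrs (y ∷ T) z ++ map (colour colouring z) (nbrs S z)
    V↭ : V ↭ (x ∷ S) ++ (y ∷ T)
    V↭ = ↭-trans V↭xyV′ (prep x (↭-trans (prep y perm) (↭-sym (shift y S T))))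
    room : ∀ {z} → z ∈ nbrs S x → length (forbidden z) + deg S x ≤ suc (length T)
    room {z} z∈ = s≤s⁻¹ (s≤s⁻¹ (*-cancelˡ-< 2 _ _ (begin-strict
      2 * suc (length (forbidden z) + deg S x)                  ≡⟨ cong (2 *_) total ⟩
      2 * (deg V x + deg V z)                                   ≤⟨ bound z∈V xz ⟩
      2 + length V                                              ≡⟨ cong (2 +_) (↭-length V↭) ⟩
      2 + suc (length (S ++ y ∷ T))                             ≡⟨ cong (3 +_) (length-++ S) ⟩
      3 + (length S + suc (length T))                           ≤⟨ +-monoʳ-≤ 3 (+-monoˡ-≤ _ S≤1+T) ⟩
      -- This number is odd; raising it by one makes it even, so that the inequality can be halved.
      3 + (suc (length T) + suc (length T))                     <⟨ n<1+n _ ⟩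
      4 + (suc (length T) + suc (length T))                     ≡⟨ arith (length T) ⟩
      2 * suc (suc (suc (length T)))                            ∎)))
      where
      z∈S = proj₁ (∈-nbrs⁻ S z∈)
      xz = proj₂ (∈-nbrs⁻ S z∈)
      z∈V = ∈-resp-↭ (↭-sym V↭) (there (∈-++⁺ˡ z∈S))
      arith : ∀ t → 4 + (suc t + suc t) ≡ 2 * suc (suc (suc t))
      arith = solve-∀
      rearrange : ∀ a b c d → suc (a + (b + c) + d) ≡ (d + a) + suc (c + b)
      rearrange = solve-∀
      total : suc (length (forbidden z) + deg S x) ≡ deg V x + deg V z
      total = begin-equality
        suc (length (forbidden z) + deg S x)
          ≡⟨ cong (λ l → suc (l + deg S x)) (trans (length-++ (nbrs (y ∷ T) x))
               (cong (deg (y ∷ T) x +_) (trans (length-++ (nbrs (y ∷ T) z))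
                 (cong (deg (y ∷ T) z +_) (length-map _ (nbrs S z)))))) ⟩
        suc (deg (y ∷ T) x + (deg (y ∷ T) z + deg S z) + deg S x)
          ≡⟨ rearrange (deg (y ∷ T) x) (deg (y ∷ T) z) (deg S z) (deg S x) ⟩
        (deg S x + deg (y ∷ T) x) + suc (deg S z + deg (y ∷ T) z)
          ≡⟨ cong₂ (λ k l → k + suc l) (deg-++ S (y ∷ T) x) (deg-++ S (y ∷ T) z) ⟨
        deg (S ++ y ∷ T) x + suc (deg (S ++ y ∷ T) z)
          ≡⟨ cong₂ _+_ (trans (deg-↭ V↭ x) (deg-∷-self x _)) (trans (deg-↭ V↭ z) (deg-∷ _ (H-sym xz))) ⟨
        deg V x + deg V z ∎
    xST! : Unique (x ∷ S) × Unique (y ∷ T)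
    xST! = Unique-++⁻ (x ∷ S) (Unique-resp-↭ V↭ V!)
    extended : Colouring (x ∷ S) (y ∷ T)
    extended with f , f-ok , f-inj ← greedyRepresentatives (proj₂ xST!) forbidden (nbrs S x)
                    (Unique.filter⁺ (H? x) (AllPairs.tail (proj₁ xST!))) room =
      addVertex (restrict colouring (λ u∈ v∈ _ → u∈ , v∈) there) x f
        (λ z∈S xz →
          let t∈ , t∉ = f-ok (∈-nbrs⁺ z∈S xz)
          in t∈ , (λ xt → t∉ (∈-++⁺ˡ (∈-nbrs⁺ t∈ xt)))
                , (λ zt → t∉ (∈-++⁺ʳ (nbrs (y ∷ T) x) (∈-++⁺ˡ (∈-nbrs⁺ t∈ zt)))))
        (λ z∈S z′∈S xz xz′ → f-inj (∈-nbrs⁺ z∈S xz) (∈-nbrs⁺ z′∈S xz′))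
        (λ {z} z∈S v∈S xz zv eq → proj₂ (f-ok (∈-nbrs⁺ z∈S xz))
          (∈-++⁺ʳ (nbrs (y ∷ T) x) (∈-++⁺ʳ (nbrs (y ∷ T) z)
            (subst (_∈ _) eq (∈-map⁺ (colour colouring z) (∈-nbrs⁺ v∈S zv))))))

  -- With δ = `deg V x`, density says |V| ≤ 2 deg z + 2δ - 3. For δ ≤ 1 the neighbourhood of `z` is
  -- at least half of `V`; for δ = 2 the bound is exactly the one `starSplit` asks for.
  denseSplit : ∀ {V x z} → C4-free V → Unique V → x ∈ V → (∀ {v} → v ∈ V → deg V x ≤ deg V v) →
    z ∈ V → H x z → 3 + length V ≤ 2 * (deg V x + deg V z) → Split V
  denseSplit {V} {x} {z} c4-free V! x∈V min z∈V xz dense = byMinDegree (deg V x) refl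
    where
    byMinDegree : ∀ δ → deg V x ≡ δ → Split V
    byMinDegree 0 eq = cliqueSplit V z
      (≤-trans (m≤n+m _ 3) (subst (λ δ → 3 + length V ≤ 2 * (δ + deg V z)) eq dense))
    byMinDegree 1 eq = cliqueSplit V z (≤-trans (n≤1+n _) (+-cancelˡ-≤ 2 _ _ (begin
      3 + length V               ≤⟨ dense ⟩
      2 * (deg V x + deg V z)    ≡⟨ cong (λ δ → 2 * (δ + deg V z)) eq ⟩
      2 * (1 + deg V z)          ≡⟨ *-distribˡ-+ 2 1 (deg V z) ⟩
      2 + 2 * deg V z            ∎)))
    byMinDegree 2 eq = starSplit V c4-free V! z∈V 2≤dz (λ w∈V _ → subst (_≤ deg V _) eq (min w∈V))
      (+-cancelˡ-≤ 3 _ _ (begin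
        3 + length V               ≤⟨ dense ⟩
        2 * (deg V x + deg V z)    ≡⟨ cong (λ δ → 2 * (δ + deg V z)) eq ⟩
        2 * (2 + deg V z)          ≡⟨ *-distribˡ-+ 2 2 (deg V z) ⟩
        4 + 2 * deg V z            ∎))
      where
      2≤dz = subst (_≤ deg V z) eq (min z∈V)
    -- Here δ = 3 + `p` and deg z = 3 + `q`, so 4 + δ · deg z - 2(δ + deg z) = (δ - 2)(deg z - 2) is
    -- positive, against density and δ · deg z < |V|.
    byMinDegree (suc (suc (suc p))) eq = contradiction dense (<⇒≱ (begin-strict
        2 * (deg V x + deg V z)                     ≡⟨ cong₂ (λ k l → 2 * (k + l)) eq dz≡ ⟩
        2 * ((3 + p) + (3 + q))                     <⟨ s≤s (m≤m+n _ (p + q + q * p)) ⟩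
        suc (2 * ((3 + p) + (3 + q)) + (p + q + q * p)) ≡⟨ arith p q ⟩
        4 + (3 + q) * (3 + p)                       ≡⟨ cong₂ (λ k l → 4 + l * k) eq dz≡ ⟨
        4 + deg V z * deg V x                       ≤⟨ +-monoʳ-≤ 3 (minDegree*degree<length V c4-free V! z∈V min) ⟩
        3 + length V                                ∎))
      where
      dz≥3 : 3 ≤ deg V z
      dz≥3 = ≤-trans (≤-trans (m≤m+n 3 p) (≤-reflexive (sym eq))) (min z∈V)
      q = deg V z ∸ 3
      dz≡ : deg V z ≡ 3 + q
      dz≡ = sym (m+[n∸m]≡n dz≥3)
      arith : ∀ p q → suc (2 * ((3 + p) + (3 + q)) + (p + q + q * p)) ≡ 4 + (3 + q) * (3 + p)
      arith = solve-∀

  -- Case distinction and induction on the vertex list.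

  HasSquare : List A → Set
  HasSquare V = Any (λ p → Any (λ q → Any (λ r → Any (λ s →
    p ≢ r × q ≢ s × H p q × H q r × H r s × H s p) V) V) V) V

  hasSquare? : ∀ V → Dec (HasSquare V)
  hasSquare? V = any? (λ p → any? (λ q → any? (λ r → any? (λ s →
    ¬? (p ≟ r) ×-dec ¬? (q ≟ s) ×-dec H? p q ×-dec H? q r ×-dec H? r s ×-dec H? s p) V) V) V) V

  ¬HasSquare⇒C4-free : ∀ {V} → ¬ HasSquare V → C4-free V
  ¬HasSquare⇒C4-free ∄square p∈ q∈ r∈ s∈ p≢r q≢s pq qr rs sp =
    ∄square (lose p∈ (lose q∈ (lose r∈ (lose s∈ (p≢r , q≢s , pq , qr , rs , sp)))))

  SplitSmaller : List A → Set
  SplitSmaller V = ∀ {U} → length U < length V → Unique U → Split U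

  squareSplit : ∀ V → Unique V → HasSquare V → SplitSmaller V → Split V
  squareSplit V V! ∃square smaller
    with a , _ , ∃₃ ← find ∃square
    with b , b∈V , ∃₂ ← find ∃₃
    with a′ , a′∈V , ∃₁ ← find ∃₂
    with b′ , _ , a≢a′ , b≢b′ , ab , ba′ , a′b′ , b′a ← find ∃₁ =
    bicliqueSplit V a′∈V a≢a′ b≢b′ ab ba′ a′b′ b′a (smaller rest<V rest!)
    where
    rest! : Unique (rest V a b)
    rest! = Unique.filter⁺ (¬? ∘ H? b) (Unique.filter⁺ (¬? ∘ H? a) V!)
    rest⁻ : ∀ {t} → t ∈ rest V a b → t ∈ V × ¬ H a t
    rest⁻ t∈ = ∈-filter⁻ (¬? ∘ H? a) (proj₁ (∈-filter⁻ (¬? ∘ H? b) {xs = non-nbrs V a} t∈))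
    rest<V : length (rest V a b) < length V
    -- The vertex `b` has been removed, being an H-neighbour of `a`.
    rest<V = Unique-⊆⇒length-≤ {xs = b ∷ rest V a b}
      (All.tabulate (λ t∈ b≡t → proj₂ (rest⁻ t∈) (subst (H a) b≡t ab)) ∷ rest!) λ where
        (here refl) → b∈V
        (there t∈)  → proj₁ (rest⁻ t∈)

  sparseSplit : ∀ {V x} → Unique V → x ∈ V →
    (∀ {z} → z ∈ V → H x z → 2 * (deg V x + deg V z) ≤ 2 + length V) → SplitSmaller V → Split V
  sparseSplit {x = x} V! x∈V sparse smaller with ∈⇒↭-∷ x∈V
  ... | []     , V↭ = balance [ x ] [] V↭ z≤n (independentColouring λ where
        (here refl) (here refl) → H-irrefl)
  ... | y ∷ V′ , V↭ = extendSplit V! V↭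
        (smaller (≤-trans (n≤1+n _) (≤-reflexive (sym (↭-length V↭))))
          (AllPairs.tail (AllPairs.tail (Unique-resp-↭ V↭ V!))))
        sparse

  splitStep : ∀ {v} V → v ∈ V → Unique V → SplitSmaller V → Split V
  splitStep V v∈V V! smaller with hasSquare? V
  ... | yes ∃square = squareSplit V V! ∃square smaller
  ... | no ∄square
        with x , x∈V , min ← minimiser (deg V) v∈V
        with any? (λ z → 3 + length V ≤? 2 * (deg V x + deg V z)) (nbrs V x)
  ...   | yes ∃dense =
    let z , z∈N , dense = find ∃dense
        z∈V , xz = ∈-nbrs⁻ V z∈N
    in denseSplit (¬HasSquare⇒C4-free ∄square) V! x∈V min z∈V xz dense
  ...   | no ∄dense = sparseSplit V! x∈V
    -- The negation of density is exactly the bound that `extendSplit` needs.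
    (λ z∈V xz → s≤s⁻¹ (≰⇒> λ dense → ∄dense (lose (∈-nbrs⁺ z∈V xz) dense))) smaller

  -- The bound `m` on the length turns the strong induction into a structural one.
  split : ∀ m V → length V ≤ m → Unique V → Split V
  split _       []           _        _  = balance [] [] ↭-refl z≤n (independentColouring λ ())
  split (suc m) V@(_ ∷ _) (s≤s V≤m) V! =
    splitStep V (here refl) V! λ {U} U<V U! → split m U (≤-trans (s≤s⁻¹ U<V) V≤m) U!

-- The complement of `G` as the graph `H`.

module _ {n : ℕ} (G : Graph n) where

  -- The diagonal has to be excluded, since `adj G u u` is `false` as well.
  NonAdj : Fin n → Fin n → Set
  NonAdj u v = u ≢ v × adj G u v ≡ false

  nonAdj? : ∀ u v → Dec (NonAdj u v)
  nonAdj? u v = ¬? (u Fin.≟ v) ×-dec (adj G u v Bool.≟ false)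

  nonAdj-sym : ∀ {u v} → NonAdj u v → NonAdj v u
  nonAdj-sym (u≢v , uv) = ≢-sym u≢v , trans (Graph.sym G _ _) uv

  ¬nonAdj⇒adj : ∀ {u v} → u ≢ v → ¬ NonAdj u v → Adj G u v
  ¬nonAdj⇒adj u≢v ¬uv = Bool.¬-not λ uv → ¬uv (u≢v , uv)

  nonAdj⇒¬adj : ∀ {u v} → NonAdj u v → ¬ Adj G u v
  nonAdj⇒¬adj (_ , uv) uv′ with () ← trans (sym uv) uv′

  nonAdj-triangle-free : IndepNumberAtMost G 2 →
    ∀ {u v w} → NonAdj u v → NonAdj v w → ¬ NonAdj u w
  nonAdj-triangle-free α≤2 {u} {v} {w} uv vw uw = <⇒≱ (n<1+n 2) (α≤2 (u ∷ v ∷ w ∷ [])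
    ( (proj₁ uv ∷ proj₁ uw ∷ []) ∷ (proj₁ vw ∷ []) ∷ [] ∷ []
    , (nonAdj⇒¬adj uv ∷ nonAdj⇒¬adj uw ∷ []) ∷ (nonAdj⇒¬adj vw ∷ []) ∷ [] ∷ []))

  -- Vertices with the same image have the same row in the adjacency matrix of `K`. For the house
  -- this spares separate proofs that the five images are distinct.
  twinFree⇒injective : ∀ {m} (K : Graph m) {f : Fin m → Fin n} →
    (∀ i j → (∀ k → adj K i k ≡ adj K j k) → i ≡ j) →
    (∀ i j → adj G (f i) (f j) ≡ adj K i j) → Injective _≡_ _≡_ f
  twinFree⇒injective K {f} twinFree f-adj {i} {j} fi≡fj = twinFree i j λ k →
    trans (sym (f-adj i k)) (trans (cong (λ v → adj G v (f k)) fi≡fj) (f-adj j k))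

  oneWallHouse-twinFree : ∀ i j → (∀ k → houseAdj i k ≡ houseAdj j k) → i ≡ j
  oneWallHouse-twinFree = toWitness
    {a? = Fin.all? λ i → Fin.all? λ j → Fin.all? (λ k → houseAdj i k Bool.≟ houseAdj j k) →-dec (i Fin.≟ j)} _

  -- If w were adjacent to r, then w, q, p, r, s would be a one-wall house on a, b, c, d, e.
  nonAdj-c4-twins : IndepNumberAtMost G 2 → ¬ HasInducedCopy G oneWallHouse →
    ∀ {p q r s w} → p ≢ r → q ≢ s →
    NonAdj p q → NonAdj q r → NonAdj r s → NonAdj s p → NonAdj w p → NonAdj w r
  nonAdj-c4-twins α≤2 houseFree {p} {q} {r} {s} {w} p≢r q≢s pq qr rs sp wp =
    decidable-stable (nonAdj? w r) λ ¬wr →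
      let
        tri = nonAdj-triangle-free α≤2
        -- Distinct vertices with a common H-neighbour are adjacent in `G`. Here `w` differs from
        -- `q` and `s`, because these are H-adjacent to `r` and `w` is not.
        wq = ¬nonAdj⇒adj (λ { refl → ¬wr qr }) (tri wp pq)
        qs = ¬nonAdj⇒adj q≢s (tri qr rs)
        ws = ¬nonAdj⇒adj (λ { refl → ¬wr (nonAdj-sym rs) }) (tri wp (nonAdj-sym sp))
        ¬pr = tri pq qr
        wr = ¬nonAdj⇒adj (λ { refl → ¬pr (nonAdj-sym wp) }) ¬wr
        pr = ¬nonAdj⇒adj p≢r ¬pr
        f-adj = house wq qs ws wr pr (proj₂ wp) (proj₂ pq) (proj₂ qr) (proj₂ sp) (proj₂ rs)
      in houseFree (lookup (w ∷ q ∷ p ∷ r ∷ s ∷ []) ,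
           twinFree⇒injective oneWallHouse oneWallHouse-twinFree f-adj , f-adj)
    where
    flip : ∀ {u v b} → adj G u v ≡ b → adj G v u ≡ b
    flip = trans (Graph.sym G _ _)
    house : ∀ {a b c d e} → Adj G a b → Adj G b e → Adj G a e → Adj G a d → Adj G c d →
      adj G a c ≡ false → adj G c b ≡ false → adj G b d ≡ false → adj G e c ≡ false → adj G d e ≡ false →
      ∀ i j → adj G (lookup (a ∷ b ∷ c ∷ d ∷ e ∷ []) i) (lookup (a ∷ b ∷ c ∷ d ∷ e ∷ []) j) ≡ houseAdj i j
    house ab be ae ad cd ac cb bd ec de = λ where
      0F 0F → irrefl G _ ; 0F 1F → ab      ; 0F 2F → ac      ; 0F 3F → ad      ; 0F 4F → ae
      1F 0F → flip ab    ; 1F 1F → irrefl G _ ; 1F 2F → flip cb ; 1F 3F → bd   ; 1F 4F → be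
      2F 0F → flip ac    ; 2F 1F → cb      ; 2F 2F → irrefl G _ ; 2F 3F → cd   ; 2F 4F → flip ec
      3F 0F → flip ad    ; 3F 1F → flip bd ; 3F 2F → flip cd ; 3F 3F → irrefl G _ ; 3F 4F → de
      4F 0F → flip ae    ; 4F 1F → flip be ; 4F 2F → ec      ; 4F 3F → flip de ; 4F 4F → irrefl G _

-- From a split to an immersion.

lookup-injective : ∀ {A : Set} {xs : List A} → Unique xs → Injective _≡_ _≡_ (lookup xs)
lookup-injective (_ ∷ _)    {Fin.zero}  {Fin.zero}  _  = refl
lookup-injective (x∉ ∷ _)   {Fin.zero}  {Fin.suc j} eq = contradiction eq (All.lookup x∉ (∈-lookup j))
lookup-injective (x∉ ∷ _)   {Fin.suc i} {Fin.zero}  eq = contradiction (sym eq) (All.lookup x∉ (∈-lookup i))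
lookup-injective (_ ∷ xs!)  {Fin.suc i} {Fin.suc j} eq = cong Fin.suc (lookup-injective xs! eq)

module _ {n : ℕ} (G : Graph n)
  (α≤2 : IndepNumberAtMost G 2) (houseFree : ¬ HasInducedCopy G oneWallHouse) where

  open Splitting Fin._≟_ (NonAdj G) (nonAdj? G) (nonAdj-sym G)
    (nonAdj-triangle-free G α≤2) (nonAdj-c4-twins G α≤2 houseFree) public

  split⇒immersion : Split (allFin n) → ContainsKImmersion G ⌈ n /2⌉
  split⇒immersion splitting = φ , P , φ-inj , paths , interior , edgeDisjoint
    where
    open Split splitting
    open Colouring colouring

    ST! : Unique (S ++ T)
    ST! = Unique-resp-↭ perm (Unique.allFin⁺ n)

    S∌T : ∀ {x} → x ∈ S → x ∉ T
    S∌T = Unique-++⇒disjoint S ST!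

    m≤S : ⌈ n /2⌉ ≤ length S
    m≤S = begin
      ⌈ n /2⌉                     ≡⟨ cong ⌈_/2⌉ (length-tabulate {n = n} (λ i → i)) ⟨
      ⌈ length (allFin n) /2⌉     ≡⟨ cong ⌈_/2⌉ (trans (↭-length perm) (length-++ S)) ⟩
      ⌈ length S + length T /2⌉   ≤⟨ ⌈n/2⌉-mono (+-monoʳ-≤ (length S) T≤S) ⟩
      ⌈ length S + length S /2⌉   ≡⟨ n≡⌈n+n/2⌉ (length S) ⟨
      length S                    ∎

    φ : Fin ⌈ n /2⌉ → Fin n
    φ i = lookup S (inject≤ i m≤S)

    φ∈S : ∀ i → φ i ∈ S
    φ∈S i = ∈-lookup (inject≤ i m≤S)

    φ-inj : Injective _≡_ _≡_ φ
    φ-inj eq = Fin.inject≤-injective m≤S m≤S _ _ (lookup-injective (proj₁ (Unique-++⁻ S ST!)) eq)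

    φ≢ : ∀ {u v} → u Fin.< v → φ u ≢ φ v
    φ≢ u<v = Fin.<⇒≢ u<v ∘ φ-inj

    inner : Fin n → Fin n → List (Fin n)
    inner a b = if adj G a b then [] else [ colour a b ]

    P : Fin ⌈ n /2⌉ → Fin ⌈ n /2⌉ → List (Fin n)
    P u v = inner (φ u) (φ v)

    isPath : ∀ {a b} → a ∈ S → b ∈ S → a ≢ b → IsPath G (a ∷ inner a b ++ b ∷ [])
    isPath {a} {b} a∈ b∈ a≢b with adj G a b in ab
    ... | true  = (a≢b ∷ []) ∷ [] ∷ [] , ab ∷ [-]
    ... | false =
      (a≢c ∷ a≢b ∷ []) ∷ (≢-sym b≢c ∷ []) ∷ [] ∷ [] ,
      ¬nonAdj⇒adj G a≢c (colour-free a∈ b∈ (a≢b , ab)) ∷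
      -- `colour-free` concerns the first end only; `colour-sym` transfers it to `b`.
      trans (Graph.sym G _ _) (¬nonAdj⇒adj G b≢c (subst (¬_ ∘ NonAdj G b) (sym (colour-sym a∈ b∈ (a≢b , ab)))
        (colour-free b∈ a∈ (nonAdj-sym G (a≢b , ab))))) ∷ [-]
      where
      c∈T = colour-∈ a∈ b∈ (a≢b , ab)
      a≢c : a ≢ colour a b
      a≢c eq = S∌T a∈ (subst (_∈ T) (sym eq) c∈T)
      b≢c : b ≢ colour a b
      b≢c eq = S∌T b∈ (subst (_∈ T) (sym eq) c∈T)

    paths : ∀ u v → u Fin.< v → IsPath G (φ u ∷ P u v ++ φ v ∷ [])
    paths u v u<v = isPath (φ∈S u) (φ∈S v) (φ≢ u<v)

    interior : ∀ u v → u Fin.< v → All (λ w → ∀ t → w ≢ φ t) (P u v)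
    interior u v u<v with adj G (φ u) (φ v) in uv
    ... | true  = []
    ... | false = (λ t eq → S∌T (φ∈S t) (subst (_∈ T) eq (colour-∈ (φ∈S u) (φ∈S v) (φ≢ u<v , uv)))) ∷ []

    second : Fin n → Fin n → Fin n
    second a b = if adj G a b then b else colour a b

    StartsWith : Fin n → Fin n → Fin n → Fin n → Set
    StartsWith a b x y = (x ≡ a × y ≡ second a b) ⊎ (y ≡ a × x ≡ second a b)

    -- A path with at most one interior vertex has no edges but the first ones seen from its two
    -- ends, so it suffices to compare first edges.
    usesEdge⇒startsWith : ∀ {a b x y} → a ∈ S → b ∈ S → a ≢ b →
      UsesEdge G (a ∷ inner a b ++ b ∷ []) x y → StartsWith a b x y ⊎ StartsWith b a x y
    usesEdge⇒startsWith {a} {b} a∈ b∈ a≢b uses with adj G a b in ab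
    usesEdge⇒startsWith a∈ b∈ a≢b (inj₁ (here refl)) | true = inj₁ (inj₁ (refl , refl))
    usesEdge⇒startsWith a∈ b∈ a≢b (inj₂ (here refl)) | true = inj₁ (inj₂ (refl , refl))
    usesEdge⇒startsWith a∈ b∈ a≢b (inj₁ (here refl)) | false = inj₁ (inj₁ (refl , refl))
    usesEdge⇒startsWith a∈ b∈ a≢b (inj₂ (here refl)) | false = inj₁ (inj₂ (refl , refl))
    usesEdge⇒startsWith a∈ b∈ a≢b (inj₁ (there (here refl))) | false
      rewrite trans (Graph.sym G _ _) ab = inj₂ (inj₂ (refl , colour-sym a∈ b∈ (a≢b , ab)))
    usesEdge⇒startsWith a∈ b∈ a≢b (inj₂ (there (here refl))) | false
      rewrite trans (Graph.sym G _ _) ab = inj₂ (inj₁ (refl , colour-sym a∈ b∈ (a≢b , ab)))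

    -- Midpoints lie in `T`, which is disjoint from `S`.
    second-∈S : ∀ {a b} → a ∈ S → b ∈ S → a ≢ b → second a b ∈ S → b ≡ second a b
    second-∈S {a} {b} a∈ b∈ a≢b second∈ with adj G a b in ab
    ... | true  = refl
    ... | false = contradiction (colour-∈ a∈ b∈ (a≢b , ab)) (S∌T second∈)

    second-inj : ∀ {a b b′} → a ∈ S → b ∈ S → b′ ∈ S → a ≢ b → a ≢ b′ → second a b ≡ second a b′ → b ≡ b′
    second-inj {a} {b} {b′} a∈ b∈ b′∈ a≢b a≢b′ eq with adj G a b in ab | adj G a b′ in ab′
    ... | true  | true  = eq
    ... | true  | false = contradiction (colour-∈ a∈ b′∈ (a≢b′ , ab′)) (S∌T (subst (_∈ S) eq b∈))
    ... | false | true  = contradiction (colour-∈ a∈ b∈ (a≢b , ab)) (S∌T (subst (_∈ S) (sym eq) b′∈))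
    ... | false | false = colour-inj a∈ b∈ b′∈ (a≢b , ab) (a≢b′ , ab′) eq

    SamePair : Fin n → Fin n → Fin n → Fin n → Set
    SamePair a b a′ b′ = (a ≡ a′ × b ≡ b′) ⊎ (a ≡ b′ × b ≡ a′)

    -- If both paths leave the same vertex along the edge, properness of the colouring applies. If
    -- they traverse it in opposite directions, both second vertices lie in `S`, so each path is
    -- that single edge of `G`.
    startsWith-unique : ∀ {a b a′ b′ x y} → a ∈ S → b ∈ S → a ≢ b → a′ ∈ S → b′ ∈ S → a′ ≢ b′ →
      StartsWith a b x y → StartsWith a′ b′ x y → SamePair a b a′ b′
    startsWith-unique a∈ b∈ a≢b _ b′∈ a≢b′ (inj₁ (refl , y≡)) (inj₁ (refl , y≡′)) =
      inj₁ (refl , second-inj a∈ b∈ b′∈ a≢b a≢b′ (trans (sym y≡) y≡′))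
    startsWith-unique a∈ b∈ a≢b _ b′∈ a≢b′ (inj₂ (refl , x≡)) (inj₂ (refl , x≡′)) =
      inj₁ (refl , second-inj a∈ b∈ b′∈ a≢b a≢b′ (trans (sym x≡) x≡′))
    startsWith-unique a∈ b∈ a≢b a′∈ b′∈ a′≢b′ (inj₁ (refl , y≡)) (inj₂ (refl , x≡)) =
      inj₂ ( trans x≡ (sym (second-∈S a′∈ b′∈ a′≢b′ (subst (_∈ S) x≡ a∈)))
           , trans (second-∈S a∈ b∈ a≢b (subst (_∈ S) y≡ a′∈)) (sym y≡))
    startsWith-unique a∈ b∈ a≢b a′∈ b′∈ a′≢b′ (inj₂ (refl , x≡)) (inj₁ (refl , y≡)) =
      inj₂ ( trans y≡ (sym (second-∈S a′∈ b′∈ a′≢b′ (subst (_∈ S) y≡ a∈)))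
           , trans (second-∈S a∈ b∈ a≢b (subst (_∈ S) x≡ a′∈)) (sym x≡))

    samePair : ∀ {a b a′ b′ x y} → a ∈ S → b ∈ S → a ≢ b → a′ ∈ S → b′ ∈ S → a′ ≢ b′ →
      UsesEdge G (a ∷ inner a b ++ b ∷ []) x y → UsesEdge G (a′ ∷ inner a′ b′ ++ b′ ∷ []) x y →
      SamePair a b a′ b′
    samePair a∈ b∈ a≢b a′∈ b′∈ a′≢b′ uses uses′
      with usesEdge⇒startsWith a∈ b∈ a≢b uses | usesEdge⇒startsWith a′∈ b′∈ a′≢b′ uses′
    ... | inj₁ s | inj₁ s′ = startsWith-unique a∈ b∈ a≢b a′∈ b′∈ a′≢b′ s s′
    ... | inj₁ s | inj₂ s′ = Sum.swap (startsWith-unique a∈ b∈ a≢b b′∈ a′∈ (≢-sym a′≢b′) s s′)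
    ... | inj₂ s | inj₁ s′ = Sum.swap
      (Sum.map swap swap (startsWith-unique b∈ a∈ (≢-sym a≢b) a′∈ b′∈ a′≢b′ s s′))
    ... | inj₂ s | inj₂ s′ =
      Sum.map swap swap (startsWith-unique b∈ a∈ (≢-sym a≢b) b′∈ a′∈ (≢-sym a′≢b′) s s′)

    edgeDisjoint : ∀ u v u′ v′ → u Fin.< v → u′ Fin.< v′ → ¬ (u ≡ u′ × v ≡ v′) → ∀ x y →
      UsesEdge G (φ u ∷ P u v ++ φ v ∷ []) x y → UsesEdge G (φ u′ ∷ P u′ v′ ++ φ v′ ∷ []) x y → ⊥
    edgeDisjoint u v u′ v′ u<v u′<v′ differ x y uses uses′
      with samePair (φ∈S u) (φ∈S v) (φ≢ u<v) (φ∈S u′) (φ∈S v′) (φ≢ u′<v′) uses uses′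
    ... | inj₁ (u≡u′ , v≡v′) = differ (φ-inj u≡u′ , φ-inj v≡v′)
    -- Both index pairs are increasing, so neither is the reverse of the other.
    ... | inj₂ (u≡v′ , v≡u′) =
      <-asym u<v (subst₂ (λ i j → toℕ i < toℕ j) (sym (φ-inj v≡u′)) (sym (φ-inj u≡v′)) u′<v′)

theorem4p3 : (n : ℕ) (G : Graph n) → IndepNumberAtMost G 2 → ¬ HasInducedCopy G oneWallHouse →
    ContainsKImmersion G ⌈ n /2⌉
theorem4p3 n G α≤2 houseFree = split⇒immersion G α≤2 houseFree
  (split G α≤2 houseFree n (allFin n) (≤-reflexive (length-tabulate _)) (Unique.allFin⁺ n))
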